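{- Let $\mathcal{X}$ be one of $\mathcal{HA}$, $\mathcal{IL}$, $\mathcal{O}$, $\mathcal{IL}\cup\mathcal{O}$, let $U\in\mathcal{X}$ and let $N$ be any term. Then $\neg U$, $U\land N$, $U\lor N$ and $U\rightarrow N$ all belong to $\mathcal{X}$.
   Context: $\Lambda^\infty$ is the set of finite and infinite $\lambda$-terms (grammar $M::=x\mid\lambda x.M\mid(MM)$ read coinductively). $\twoheadrightarrow_\beta$ is finite $\beta$-reduction; "strongly-convergently reduces" refers to possibly infinite converging $\beta$-reduction. A term is root-active if every reduct of it can be further reduced to a redex. $\mathcal{HA}=\{M\in\Lambda^\infty\mid M\twoheadrightarrow_\beta \lambda x_1\ldots x_n.R P_1\ldots P_k$ for some root-active $R\}$; $\mathcal{IL}=\{M\in\Lambda^\infty\mid M$ strongly-convergently reduces to a term $\lambda x_1\ldots x_n.((\ldots P_2)P_1)$ with an infinite left spine$\}$; $\mathcal{O}=\{M\in\Lambda^\infty\mid M$ strongly-convergently reduces to $\mathbf{O}\equiv\lambda x_1\lambda x_2\lambda x_3\ldots\}$. Encoding: $\mathbf{T}\equiv\lambda xy.x$, $\mathbf{F}\equiv\lambda xy.y$, $\neg M\equiv M\,\mathbf{F}\,\mathbf{T}$, $M\land N\equiv M\,N\,M$, $M\lor N\equiv M\,M\,N$, $M\rightarrow N\equiv M\,N\,\mathbf{T}$. -}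

module Defs where

open import Level using (Level; Lift; _⊔_) renaming (suc to lsuc; zero to lzero)
open import Data.Nat using (ℕ; zero; suc; _+_; _<ᵇ_; compare; less; equal; greater)
open import Data.Bool using (if_then_else_)
open import Data.Unit using (⊤; tt)
open import Data.Empty using (⊥)
open import Data.Sum using (_⊎_; inj₁; inj₂)
open import Data.Product using (Σ; ∃; _×_; _,_)
open import Relation.Binary.PropositionalEquality using (_≡_)

-- Coinductive types are unavailable here (--guardedness is not allowed),
-- so a possibly infinite term is represented as a pointed coalgebra of the
-- signature functor F X = ℕ + X + X×X: a state space, a node-map and a
-- root state.  The term denoted is the unfolding of the root; terms are
-- identified up to bisimilarity _≈_ (= equality of the unfolded trees).

data F {ℓ} (X : Set ℓ) : Set ℓ where
  var : ℕ → F X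
  lam : X → F X
  app : X → X → F X

mapF : ∀ {a b} {X : Set a} {Y : Set b} → (X → Y) → F X → F Y
mapF f (var i)   = var i
mapF f (lam x)   = lam (f x)
mapF f (app x y) = app (f x) (f y)

FRel : ∀ {a b r} {X : Set a} {Y : Set b} → (X → Y → Set r) → F X → F Y → Set r
FRel R (var i)   (var j)   = Lift _ (i ≡ j)
FRel R (lam x)   (lam y)   = R x y
FRel R (app x x') (app y y') = R x y × R x' y'
FRel R _         _         = Lift _ ⊥

record Tm : Set₁ where
  field
    St   : Set
    step : St → F St
    root : St
open Tm public

at : (M : Tm) → St M → Tm
at M s = record { St = St M ; step = step M ; root = s }

out : Tm → F Tm
out M = mapF (at M) (step M (root M))

_≈_ : Tm → Tm → Set₁
M ≈ N = Σ (St M → St N → Set) λ R →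
          R (root M) (root N) × (∀ s t → R s t → FRel R (step M s) (step N t))

varₜ : ℕ → Tm
varₜ i = record { St = ⊤ ; step = λ _ → var i ; root = tt }

lamₜ : Tm → Tm
lamₜ M = record { St = ⊤ ⊎ St M ; step = st ; root = inj₁ tt }
  where
  st : ⊤ ⊎ St M → F (⊤ ⊎ St M)
  st (inj₁ _) = lam (inj₂ (root M))
  st (inj₂ s) = mapF inj₂ (step M s)

_·_ : Tm → Tm → Tm
M · N = record { St = ⊤ ⊎ (St M ⊎ St N) ; step = st ; root = inj₁ tt }
  where
  st : ⊤ ⊎ (St M ⊎ St N) → F (⊤ ⊎ (St M ⊎ St N))
  st (inj₁ _)        = app (inj₂ (inj₁ (root M))) (inj₂ (inj₂ (root N)))
  st (inj₂ (inj₁ s)) = mapF (λ x → inj₂ (inj₁ x)) (step M s)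
  st (inj₂ (inj₂ s)) = mapF (λ x → inj₂ (inj₂ x)) (step N s)
infixl 9 _·_

-- β-contractum: P[Q/0] where P is the body of the abstraction
-- (indices above the substituted one are decremented, Q is shifted when
-- it is placed under binders).

module _ (P Q : Tm) where
  -- state of Q placed under k extra binders, currently under d local binders
  stepQ : St Q → ℕ → ℕ → F (St Q × ℕ × ℕ)
  stepQ s k d with step Q s
  ... | var m   = var (if m <ᵇ d then m else m + k)
  ... | lam s'  = lam (s' , k , suc d)
  ... | app a b = app (a , k , d) (b , k , d)

  SubSt : Set
  SubSt = (St P × ℕ) ⊎ (St Q × ℕ × ℕ)

  stepSub : SubSt → F SubSt
  stepSub (inj₂ q) with q
  ... | (s , k , d) = mapF inj₂ (stepQ s k d)
  stepSub (inj₁ (s , k)) with step P s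
  ... | lam s'  = lam (inj₁ (s' , suc k))
  ... | app a b = app (inj₁ (a , k)) (inj₁ (b , k))
  ... | var j with compare j k
  ...   | less _ _      = var j
  ...   | equal _       = mapF inj₂ (stepQ (root Q) k 0)
  ...   | greater _ l   = var (k + l)

  subst₀ : Tm
  subst₀ = record { St = SubSt ; step = stepSub ; root = inj₁ (root P , 0) }

data _→β_ : Tm → Tm → Set₁ where
  β    : ∀ {M N A B P} → out M ≡ app A B → out A ≡ lam P →
         subst₀ P B ≈ N → M →β N
  ξlam : ∀ {M N A A'} → out M ≡ lam A → out N ≡ lam A' → A →β A' → M →β N
  ξl   : ∀ {M N A A' B B'} → out M ≡ app A B → out N ≡ app A' B' →
         A →β A' → B ≈ B' → M →β N
  ξr   : ∀ {M N A A' B B'} → out M ≡ app A B → out N ≡ app A' B' →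
         A ≈ A' → B →β B' → M →β N

data _↠β_ : Tm → Tm → Set₁ where
  done : ∀ {M N} → M ≈ N → M ↠β N
  _◅_  : ∀ {M K N} → M →β K → K ↠β N → M ↠β N

-- Strongly convergent β-reduction ↠∞, in the coinductive presentation
-- (Endrullis–Polonsky): M ↠∞ N iff M ↠β M' for some M' whose head node
-- agrees with that of N and whose immediate subterms ↠∞ those of N.
-- Defined as the greatest fixed point (existence of a post-fixed relation).

ScStep : (Tm → Tm → Set₁) → Tm → Tm → Set₁
ScStep R M N = ∃ λ M' → M ↠β M' × FRel R (out M') (out N)

_↠∞_ : Tm → Tm → Set₂
M ↠∞ N = Σ (Tm → Tm → Set₁) λ R → R M N × (∀ K L → R K L → ScStep R K L)

Redex : Tm → Set₁
Redex M = ∃ λ A → ∃ λ B → ∃ λ P → out M ≡ app A B × out A ≡ lam P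

RootActive : Tm → Set₁
RootActive M = ∀ N → M ↠β N → ∃ λ R → N ↠β R × Redex R

data Lams (P : Tm → Set₁) : Tm → Set₁ where
  here  : ∀ {M} → P M → Lams P M
  under : ∀ {M A} → out M ≡ lam A → Lams P A → Lams P M

data Spine (P : Tm → Set₁) : Tm → Set₁ where
  here : ∀ {M} → P M → Spine P M
  left : ∀ {M A B} → out M ≡ app A B → Spine P A → Spine P M

AppLeft : {X : Set} → (X → Set) → F X → Set
AppLeft S (app a b) = S a
AppLeft S _         = ⊥

InfSpine : Tm → Set₁
InfSpine M = Σ (St M → Set) λ S → S (root M) × (∀ s → S s → AppLeft S (step M s))

𝐎 : Tm
𝐎 = record { St = ⊤ ; step = λ _ → lam tt ; root = tt }

HA : Tm → Set₁
HA M = ∃ λ N → M ↠β N × Lams (Spine RootActive) N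

IL : Tm → Set₂
IL M = ∃ λ N → M ↠∞ N × Lams InfSpine N

𝒪 : Tm → Set₂
𝒪 M = M ↠∞ 𝐎

data Class : Set where
  HA-c IL-c O-c IL∪O-c : Class

_∈_ : Tm → Class → Set₂
M ∈ HA-c   = Lift _ (HA M)
M ∈ IL-c   = IL M
M ∈ O-c    = 𝒪 M
M ∈ IL∪O-c = IL M ⊎ 𝒪 M

𝐓 : Tm
𝐓 = lamₜ (lamₜ (varₜ 1))

𝐅 : Tm
𝐅 = lamₜ (lamₜ (varₜ 0))

¬ₜ_ : Tm → Tm
¬ₜ M = M · 𝐅 · 𝐓

_∧ₜ_ : Tm → Tm → Tm
M ∧ₜ N = M · N · M

_∨ₜ_ : Tm → Tm → Tm
M ∨ₜ N = M · M · N

_⇒ₜ_ : Tm → Tm → Tm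
M ⇒ₜ N = M · N · 𝐓

{-# OPTIONS --safe #-}
-- ¬U, U ∧ N, U ∨ N and U → N all have the form U A B, so it suffices that each class is closed
-- under U ↦ U A.  Suppose U reduces to λx₁…xₙ.V with V of the required shape.  If n = 0, then
-- U A reduces to V A, which still has a root-active head or an infinite left spine.  If n ≥ 1,
-- then U A reduces to (λx₂…xₙ.V)[A/x₁] (and 𝐎[A] = 𝐎), so it remains to show that substitution
-- preserves the shapes, root-activeness and strongly convergent reduction.
--
-- For the last two, call N an instance of M if N is M with the free variable d substituted,
-- except at holes, where M has d in head position.  A hole never becomes a redex, so every
-- reduction of M is matched by one of N, and N is a redex whenever M is.  With the spines
-- x_d P₁…Pₖ as holes and arbitrary contents in N, reductions of N are matched by M as well, so N
-- inherits root-activeness from M.  With x_d itself as hole, filled by shifted copies of the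
-- substituted term Q, instances of P and L with P ↠∞ L keep step with each other, so
-- P[Q] ↠∞ L[Q].
module Submission where

open import Defs
open import Level using (Level; Lift; lift; _⊔_; 0ℓ)
open import Data.Nat using (ℕ; suc; _+_; _<_; _≤_; _<ᵇ_; _<?_; compare; less; equal; greater)
open import Data.Nat.Properties
open import Data.Bool using (true; false; if_then_else_)
open import Data.Empty using (⊥; ⊥-elim)
open import Data.Unit using (⊤; tt)
open import Data.Sum using (_⊎_; inj₁; inj₂)
open import Data.Product using (∃; ∃₂; _×_; _,_)
open import Function using (flip; id)
open import Relation.Binary.PropositionalEquality
open import Relation.Binary.Definitions using (tri<; tri≈; tri>)
open import Relation.Nullary using (yes; no)

private variable
  a b r s : Level
  X Y Z : Set a
  M M' N N' K K' L L' A B A' B' P P' Q Q' : Tm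

-- FRel as an inductive family (matching on a proof fixes both nodes), generalised so that
-- variable indices and abstraction bodies, one binder deeper, can be related differently.
data Node {X : Set a} {Y : Set b} (V : ℕ → ℕ → Set) (Rλ Rα : X → Y → Set r) :
          F X → F Y → Set (a ⊔ b ⊔ r) where
  var : ∀ {i j} → V i j → Node V Rλ Rα (var i) (var j)
  lam : ∀ {x y} → Rλ x y → Node V Rλ Rα (lam x) (lam y)
  app : ∀ {x x' y y'} → Rα x y → Rα x' y' → Node V Rλ Rα (app x x') (app y y')

Pointwise : (R : X → Y → Set r) → F X → F Y → Set _
Pointwise R = Node _≡_ R R

module _ {V : ℕ → ℕ → Set} {Rλ Rα : X → Y → Set r} where

  Node-map : {V' : ℕ → ℕ → Set} {Rλ' Rα' : X → Y → Set s} → (∀ {i j} → V i j → V' i j) →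
             (∀ {x y} → Rλ x y → Rλ' x y) → (∀ {x y} → Rα x y → Rα' x y) →
             ∀ {f g} → Node V Rλ Rα f g → Node V' Rλ' Rα' f g
  Node-map hv hλ hα (var v)    = var (hv v)
  Node-map hv hλ hα (lam p)    = lam (hλ p)
  Node-map hv hλ hα (app p p') = app (hα p) (hα p')

  Node-respˡ : {S : Z → X → Set s} → ∀ {f' f g} → Pointwise S f' f → Node V Rλ Rα f g →
               Node V (λ z y → ∃ λ x → S z x × Rλ x y) (λ z y → ∃ λ x → S z x × Rα x y) f' g
  Node-respˡ (var refl) (var v)    = var v
  Node-respˡ (lam q)    (lam p)    = lam (_ , q , p)
  Node-respˡ (app q q') (app p p') = app (_ , q , p) (_ , q' , p')

  Node-respʳ : {S : Y → Z → Set s} → ∀ {f g g'} → Node V Rλ Rα f g → Pointwise S g g' →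
               Node V (λ x z → ∃ λ y → Rλ x y × S y z) (λ x z → ∃ λ y → Rα x y × S y z) f g'
  Node-respʳ (var v)    (var refl) = var v
  Node-respʳ (lam p)    (lam q)    = lam (_ , p , q)
  Node-respʳ (app p p') (app q q') = app (_ , p , q) (_ , p' , q')

  Node-appˡ : ∀ {f g x x'} → Node V Rλ Rα f g → f ≡ app x x' →
              ∃₂ λ y y' → g ≡ app y y' × Rα x y × Rα x' y'
  Node-appˡ (app p p') refl = _ , _ , refl , p , p'

  Node-lamˡ : ∀ {f g x} → Node V Rλ Rα f g → f ≡ lam x → ∃ λ y → g ≡ lam y × Rλ x y
  Node-lamˡ (lam p) refl = _ , refl , p

  Node-varˡ : ∀ {f g i} → Node V Rλ Rα f g → f ≡ var i → ∃ λ j → g ≡ var j × V i j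
  Node-varˡ (var v) refl = _ , refl , v

  Node-appʳ : ∀ {f g y y'} → Node V Rλ Rα f g → g ≡ app y y' →
              ∃₂ λ x x' → f ≡ app x x' × Rα x y × Rα x' y'
  Node-appʳ (app p p') refl = _ , _ , refl , p , p'

  Node-lamʳ : ∀ {f g y} → Node V Rλ Rα f g → g ≡ lam y → ∃ λ x → f ≡ lam x × Rλ x y
  Node-lamʳ (lam p) refl = _ , refl , p

  Node-varʳ : ∀ {f g j} → Node V Rλ Rα f g → g ≡ var j → ∃ λ i → f ≡ var i × V i j
  Node-varʳ (var v) refl = _ , refl , v

module _ {V : ℕ → ℕ → Set} {Rλ Rα : Z → Y → Set r} (g : X → Z) where

  Node-mapFˡ : ∀ {f h} → Node V (λ x y → Rλ (g x) y) (λ x y → Rα (g x) y) f h →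
               Node V Rλ Rα (mapF g f) h
  Node-mapFˡ (var v)    = var v
  Node-mapFˡ (lam p)    = lam p
  Node-mapFˡ (app p p') = app p p'

module _ {V : ℕ → ℕ → Set} {Rλ Rα : Y → Z → Set r} (g : X → Z) where

  Node-mapFʳ : ∀ {h f} → Node V (λ y x → Rλ y (g x)) (λ y x → Rα y (g x)) h f →
               Node V Rλ Rα h (mapF g f)
  Node-mapFʳ (var v)    = var v
  Node-mapFʳ (lam p)    = lam p
  Node-mapFʳ (app p p') = app p p'

module _ {R : X → Y → Set r} where

  FRel⇒Pointwise : ∀ f g → FRel R f g → Pointwise R f g
  FRel⇒Pointwise (var i)    (var j)    (lift e)  = var e
  FRel⇒Pointwise (lam x)    (lam y)    p         = lam p
  FRel⇒Pointwise (app x x') (app y y') (p , p') = app p p'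
  FRel⇒Pointwise (var _)    (lam _)    (lift ())
  FRel⇒Pointwise (var _)    (app _ _)  (lift ())
  FRel⇒Pointwise (lam _)    (var _)    (lift ())
  FRel⇒Pointwise (lam _)    (app _ _)  (lift ())
  FRel⇒Pointwise (app _ _)  (var _)    (lift ())
  FRel⇒Pointwise (app _ _)  (lam _)    (lift ())

  Pointwise⇒FRel : ∀ {f g} → Pointwise R f g → FRel R f g
  Pointwise⇒FRel (var e)    = lift e
  Pointwise⇒FRel (lam p)    = p
  Pointwise⇒FRel (app p p') = p , p'

  Pointwise-map : {S : X → Y → Set s} → (∀ {x y} → R x y → S x y) →
                  ∀ {f g} → Pointwise R f g → Pointwise S f g
  Pointwise-map h = Node-map id h h

  Pointwise-sym : ∀ {f g} → Pointwise R f g → Pointwise (flip R) g f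
  Pointwise-sym (var e)    = var (sym e)
  Pointwise-sym (lam p)    = lam p
  Pointwise-sym (app p p') = app p p'

  Pointwise-trans : {S : Y → Z → Set s} → ∀ {f g h} → Pointwise R f g → Pointwise S g h →
                    Pointwise (λ x z → ∃ λ y → R x y × S y z) f h
  Pointwise-trans (var e)    (var e')   = var (trans e e')
  Pointwise-trans (lam p)    (lam q)    = lam (_ , p , q)
  Pointwise-trans (app p p') (app q q') = app (_ , p , q) (_ , p' , q')

FRel-map : {R : X → Y → Set r} {S : X → Y → Set s} → (∀ {x y} → R x y → S x y) →
           ∀ f g → FRel R f g → FRel S f g
FRel-map h f g p = Pointwise⇒FRel (Pointwise-map h (FRel⇒Pointwise f g p))

Pointwise-refl : {R : X → X → Set r} → (∀ {x} → R x x) → ∀ f → Pointwise R f f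
Pointwise-refl ρ (var i)   = var refl
Pointwise-refl ρ (lam x)   = lam ρ
Pointwise-refl ρ (app x y) = app ρ ρ

-- _≈_ as a record: unlike the Σ-type, it determines the two terms, so Agda can infer them.
infix 4 _≅_
record _≅_ (M N : Tm) : Set₁ where
  constructor bisim
  field
    Rel      : St M → St N → Set
    rel-root : Rel (root M) (root N)
    rel-step : ∀ s t → Rel s t → Pointwise Rel (step M s) (step N t)
open _≅_

≈⇒≅ : M ≈ N → M ≅ N
≈⇒≅ {M} {N} (R , r , h) = bisim R r λ s t q → FRel⇒Pointwise (step M s) (step N t) (h s t q)

≅⇒≈ : M ≅ N → M ≈ N
≅⇒≈ (bisim R r h) = R , r , λ s t q → Pointwise⇒FRel (h s t q)

≅-refl : M ≅ M
≅-refl {M} = bisim _≡_ refl λ { s _ refl → Pointwise-refl refl (step M s) }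

≅-sym : M ≅ N → N ≅ M
≅-sym (bisim R r h) = bisim (flip R) r λ t s q → Pointwise-sym (h s t q)

≅-trans : M ≅ N → N ≅ K → M ≅ K
≅-trans (bisim R r h) (bisim S r' h') = bisim (λ x z → ∃ λ y → R x y × S y z) (_ , r , r')
  λ { x z (y , p , q) → Pointwise-trans (h x y p) (h' y z q) }

at-≅ : (b : M ≅ N) → ∀ {s t} → Rel b s t → at M s ≅ at N t
at-≅ (bisim R _ h) q = bisim R q h

out-≅ : M ≅ N → Pointwise _≅_ (out M) (out N)
out-≅ {M} {N} b =
  Node-mapFˡ (at M) (Node-mapFʳ (at N) (Pointwise-map (at-≅ b) (rel-step b _ _ (rel-root b))))

out-app-≅ : out M ≡ app A B → M ≅ N → ∃₂ λ A' B' → out N ≡ app A' B' × A ≅ A' × B ≅ B'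
out-app-≅ e b = Node-appˡ (out-≅ b) e

out-lam-≅ : out M ≡ lam A → M ≅ N → ∃ λ A' → out N ≡ lam A' × A ≅ A'
out-lam-≅ e b = Node-lamˡ (out-≅ b) e

out-var-≅ : ∀ {i} → out M ≡ var i → M ≅ N → out N ≡ var i
out-var-≅ e b with Node-varˡ (out-≅ b) e
... | _ , e' , refl = e'

out-app-inv : out M ≡ app A B → ∃₂ λ a b → step M (root M) ≡ app a b × at M a ≡ A × at M b ≡ B
out-app-inv {M} e with step M (root M) | e
... | app a b | refl = a , b , refl , refl , refl

out-lam-inv : out M ≡ lam A → ∃ λ a → step M (root M) ≡ lam a × at M a ≡ A
out-lam-inv {M} e with step M (root M) | e
... | lam a | refl = a , refl , refl

out-var-inv : ∀ {i} → out M ≡ var i → step M (root M) ≡ var i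
out-var-inv {M} e with step M (root M) | e
... | var _ | refl = refl

embed-≅ : (ι : St N → St M) → (∀ t → step M (ι t) ≡ mapF ι (step N t)) → ∀ t → at M (ι t) ≅ at N t
embed-≅ {N} ι hom t = bisim (λ s t → s ≡ ι t) refl λ { _ t refl →
  subst (λ f → Pointwise (λ s t → s ≡ ι t) f (step N t)) (sym (hom t))
        (Node-mapFˡ ι (Pointwise-refl refl (step N t))) }

at-·ˡ : ∀ x → at (A · B) (inj₂ (inj₁ x)) ≅ at A x
at-·ˡ {A} {B} = embed-≅ {A} {A · B} (λ x → inj₂ (inj₁ x)) λ _ → refl

at-·ʳ : ∀ y → at (A · B) (inj₂ (inj₂ y)) ≅ at B y
at-·ʳ {A} {B} = embed-≅ {B} {A · B} (λ y → inj₂ (inj₂ y)) λ _ → refl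

at-lamₜ : ∀ x → at (lamₜ A) (inj₂ x) ≅ at A x
at-lamₜ {A} = embed-≅ {A} {lamₜ A} inj₂ λ _ → refl

same-step-≅ : ∀ {x y} → step M x ≡ step M y → at M x ≅ at M y
same-step-≅ {M} {x} {y} e = bisim R (inj₂ (refl , refl)) post
  where
  R : St M → St M → Set
  R a b = a ≡ b ⊎ (a ≡ x × b ≡ y)
  post : ∀ a b → R a b → Pointwise R (step M a) (step M b)
  post a _ (inj₁ refl)          = Pointwise-refl (inj₁ refl) (step M a)
  post _ _ (inj₂ (refl , refl)) = subst (Pointwise R (step M x)) e (Pointwise-refl (inj₁ refl) (step M x))

app-≅ : out N ≡ app A B → A ≅ A' → B ≅ B' → N ≅ A' · B'
app-≅ {N} {A' = A'} {B' = B'} e bA bB with out-app-inv {N} e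
... | _ , _ , eN , refl , refl = bisim R refl post
  where
  R : St N → St (A' · B') → Set
  R s (inj₁ _)        = s ≡ root N
  R s (inj₂ (inj₁ x)) = Rel bA s x
  R s (inj₂ (inj₂ y)) = Rel bB s y
  post : ∀ s t → R s t → Pointwise R (step N s) (step (A' · B') t)
  post _ (inj₁ _)        refl = subst (λ f → Pointwise R f _) (sym eN) (app (rel-root bA) (rel-root bB))
  post s (inj₂ (inj₁ x)) q    = Node-mapFʳ (λ z → inj₂ (inj₁ z)) (rel-step bA s x q)
  post s (inj₂ (inj₂ y)) q    = Node-mapFʳ (λ z → inj₂ (inj₂ z)) (rel-step bB s y q)

lam-≅ : out N ≡ lam A → A ≅ A' → N ≅ lamₜ A'
lam-≅ {N} {A' = A'} e bA with out-lam-inv {N} e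
... | _ , eN , refl = bisim R refl post
  where
  R : St N → St (lamₜ A') → Set
  R s (inj₁ _) = s ≡ root N
  R s (inj₂ x) = Rel bA s x
  post : ∀ s t → R s t → Pointwise R (step N s) (step (lamₜ A') t)
  post _ (inj₁ _) refl = subst (λ f → Pointwise R f _) (sym eN) (lam (rel-root bA))
  post s (inj₂ x) q    = Node-mapFʳ inj₂ (rel-step bA s x q)

module SubstCong {P P' Q Q' : Tm} (bP : P ≅ P') (bQ : Q ≅ Q') where

  data SubRel : SubSt P Q → SubSt P' Q' → Set where
    body : ∀ {s s' k} → Rel bP s s' → SubRel (inj₁ (s , k)) (inj₁ (s' , k))
    arg  : ∀ {q q' k d} → Rel bQ q q' → SubRel (inj₂ (q , k , d)) (inj₂ (q' , k , d))

  stepQ-rel : ∀ {q q'} k d → Rel bQ q q' →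
              Pointwise SubRel (mapF inj₂ (stepQ P Q q k d)) (mapF inj₂ (stepQ P' Q' q' k d))
  stepQ-rel {q} {q'} k d r with step Q q | step Q' q' | rel-step bQ q q' r
  ... | _ | _ | var refl = var refl
  ... | _ | _ | lam p    = lam (arg p)
  ... | _ | _ | app p p' = app (arg p) (arg p')

  post : ∀ x y → SubRel x y → Pointwise SubRel (stepSub P Q x) (stepSub P' Q' y)
  post _ _ (arg r) = stepQ-rel _ _ r
  post (inj₁ (s , k)) (inj₁ (s' , k)) (body r) with step P s | step P' s' | rel-step bP s s' r
  ... | _     | _ | lam p    = lam (body p)
  ... | _     | _ | app p p' = app (body p) (body p')
  ... | var j | _ | var refl with compare j k
  ...   | less _ _    = var refl
  ...   | equal _     = stepQ-rel k 0 (rel-root bQ)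
  ...   | greater _ _ = var refl

subst₀-cong : P ≅ P' → Q ≅ Q' → subst₀ P Q ≅ subst₀ P' Q'
subst₀-cong bP bQ = bisim SubRel (body (rel-root bP)) post
  where open SubstCong bP bQ

→β-respˡ : M ≅ M' → M →β N → M' →β N
→β-respˡ {N = N} b (β {B = B} {P = P} e₁ e₂ sb) with out-app-≅ e₁ b
... | _ , _ , e₁' , bA , bB with out-lam-≅ e₂ bA
... | _ , e₂' , bP =
  β e₁' e₂' (≅⇒≈ (≅-trans (subst₀-cong (≅-sym bP) (≅-sym bB)) (≈⇒≅ {subst₀ P B} {N} sb)))
→β-respˡ b (ξlam e₁ e₂ r) with out-lam-≅ e₁ b
... | _ , e₁' , bA = ξlam e₁' e₂ (→β-respˡ bA r)
→β-respˡ b (ξl {B = B} {B' = B'} e₁ e₂ r bB) with out-app-≅ e₁ b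
... | _ , _ , e₁' , bA' , bB' =
  ξl e₁' e₂ (→β-respˡ bA' r) (≅⇒≈ (≅-trans (≅-sym bB') (≈⇒≅ {B} {B'} bB)))
→β-respˡ b (ξr {A = A} {A' = A'} e₁ e₂ bA r) with out-app-≅ e₁ b
... | _ , _ , e₁' , bA' , bB' =
  ξr e₁' e₂ (≅⇒≈ (≅-trans (≅-sym bA') (≈⇒≅ {A} {A'} bA))) (→β-respˡ bB' r)

→β-respʳ : M →β N → N ≅ N' → M →β N'
→β-respʳ {N = N} (β {B = B} {P = P} e₁ e₂ sb) b =
  β e₁ e₂ (≅⇒≈ (≅-trans (≈⇒≅ {subst₀ P B} {N} sb) b))
→β-respʳ (ξlam e₁ e₂ r) b with out-lam-≅ e₂ b
... | _ , e₂' , bA = ξlam e₁ e₂' (→β-respʳ r bA)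
→β-respʳ (ξl {B = B} {B' = B'} e₁ e₂ r bB) b with out-app-≅ e₂ b
... | _ , _ , e₂' , bA , bB' = ξl e₁ e₂' (→β-respʳ r bA) (≅⇒≈ (≅-trans (≈⇒≅ {B} {B'} bB) bB'))
→β-respʳ (ξr {A = A} {A' = A'} e₁ e₂ bA r) b with out-app-≅ e₂ b
... | _ , _ , e₂' , bA' , bB = ξr e₁ e₂' (≅⇒≈ (≅-trans (≈⇒≅ {A} {A'} bA) bA')) (→β-respʳ r bB)

→β-contract : out M ≡ app A B → out A ≡ lam P → M →β subst₀ P B
→β-contract {B = B} {P = P} e₁ e₂ = β e₁ e₂ (≅⇒≈ (≅-refl {subst₀ P B}))

↠β-done : M ≅ N → M ↠β N
↠β-done b = done (≅⇒≈ b)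

↠β-refl : M ↠β M
↠β-refl = ↠β-done ≅-refl

→β⇒↠β : M →β N → M ↠β N
→β⇒↠β r = r ◅ ↠β-refl

↠β-respˡ : M ≅ M' → M ↠β N → M' ↠β N
↠β-respˡ {M} {N = N} b (done b') = ↠β-done (≅-trans (≅-sym b) (≈⇒≅ {M} {N} b'))
↠β-respˡ b (r ◅ rs) = →β-respˡ b r ◅ rs

↠β-trans : M ↠β K → K ↠β N → M ↠β N
↠β-trans {M} {K} (done b) rs  = ↠β-respˡ (≅-sym (≈⇒≅ {M} {K} b)) rs
↠β-trans (r ◅ rs)        rs' = r ◅ ↠β-trans rs rs'

↠β-appˡ : out N ≡ app A B → A ≅ A' → B ≅ B' → A' ↠β K → N ↠β (K · B')
↠β-appˡ {A' = A'} {K = K} e bA bB (done b) = ↠β-done (app-≅ e (≅-trans bA (≈⇒≅ {A'} {K} b)) bB)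
↠β-appˡ {B' = B'} e bA bB (_◅_ {K = K₁} r rs) =
  _◅_ {K = K₁ · B'} (ξl e refl (→β-respˡ (≅-sym bA) (→β-respʳ r (≅-sym (at-·ˡ _))))
                                (≅⇒≈ (≅-trans bB (≅-sym (at-·ʳ _)))))
                     (↠β-appˡ refl (at-·ˡ _) (at-·ʳ _) rs)

↠β-appʳ : out N ≡ app A B → A ≅ A' → B ≅ B' → B' ↠β K → N ↠β (A' · K)
↠β-appʳ {B' = B'} {K = K} e bA bB (done b) = ↠β-done (app-≅ e bA (≅-trans bB (≈⇒≅ {B'} {K} b)))
↠β-appʳ {A' = A'} e bA bB (_◅_ {K = K₁} r rs) =
  _◅_ {K = A' · K₁} (ξr e refl (≅⇒≈ (≅-trans bA (≅-sym (at-·ˡ _))))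
                                (→β-respˡ (≅-sym bB) (→β-respʳ r (≅-sym (at-·ʳ _)))))
                     (↠β-appʳ refl (at-·ˡ _) (at-·ʳ _) rs)

↠β-lam : out N ≡ lam A → A ≅ A' → A' ↠β K → N ↠β lamₜ K
↠β-lam {A' = A'} {K = K} e bA (done b) = ↠β-done (lam-≅ e (≅-trans bA (≈⇒≅ {A'} {K} b)))
↠β-lam e bA (_◅_ {K = K₁} r rs) =
  _◅_ {K = lamₜ K₁} (ξlam e refl (→β-respˡ (≅-sym bA) (→β-respʳ r (≅-sym (at-lamₜ _)))))
                     (↠β-lam refl (at-lamₜ _) rs)

↠β-head-β : M ↠β M' → out M' ≡ lam A → (M · B) ↠β subst₀ A B
↠β-head-β {M' = M'} {B = B} rs e with out-lam-≅ e (≅-sym (at-·ˡ {M'} {B} (root M')))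
... | _ , e' , bA = ↠β-trans (↠β-appˡ refl (at-·ˡ _) (at-·ʳ _) rs)
                             (→β-contract refl e' ◅ ↠β-done (subst₀-cong (≅-sym bA) (at-·ʳ _)))

-- The index renaming performed by stepQ.
shift : ℕ → ℕ → ℕ → ℕ
shift c k m = if m <ᵇ c then m else m + k

shift-< : ∀ {c k m} → m < c → shift c k m ≡ m
shift-< {c} {k} {m} p with m <ᵇ c | <⇒<ᵇ p
... | true | _ = refl

shift-≥ : ∀ {c k m} → c ≤ m → shift c k m ≡ m + k
shift-≥ {c} {k} {m} p with m <ᵇ c | <ᵇ⇒< m c
... | false | _   = refl
... | true  | m<c = ⊥-elim (<⇒≱ (m<c _) p)

-- SubstVar d i j: the index j ≠ d of M becomes i in M with d substituted.
data SubstVar (d : ℕ) : ℕ → ℕ → Set where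
  below : ∀ {j} → j < d → SubstVar d j j
  above : ∀ {j} → d ≤ j → SubstVar d j (suc j)

hole-or-substVar : ∀ d j → j ≡ d ⊎ ∃ λ i → SubstVar d i j
hole-or-substVar d j with <-cmp j d
... | tri< j<d _ _ = inj₂ (j , below j<d)
... | tri≈ _ j≡d _ = inj₁ j≡d
hole-or-substVar d (suc i) | tri> _ _ d<j = inj₂ (i , above (≤-pred d<j))

substVar-¬hole : ∀ {d i} → SubstVar d i d → ⊥
substVar-¬hole (below d<d) = <-irrefl refl d<d
substVar-¬hole (above i<i) = <-irrefl refl i<i

substVar-functional : ∀ {d i i' j} → SubstVar d i j → SubstVar d i' j → i ≡ i'
substVar-functional (below _)   (below _)    = refl
substVar-functional (above _)   (above _)    = refl
substVar-functional (below i<d) (above d≤i') = ⊥-elim (<⇒≱ i<d (≤-trans d≤i' (n≤1+n _)))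
substVar-functional (above d≤i) (below i'<d) = ⊥-elim (<⇒≱ i'<d (≤-trans d≤i (n≤1+n _)))

substVar-hole : ∀ {k d i} → SubstVar (suc (k + d)) i k → i ≡ k
substVar-hole (below _) = refl
substVar-hole (above p) = ⊥-elim (<⇒≱ (≤-trans (n<1+n _) (m≤m+n _ _)) (≤-pred (≤-trans p (n≤1+n _))))

substVar-comm : ∀ {k d i j j'} → SubstVar (suc (k + d)) j' j → SubstVar k i j →
                ∃ λ i' → SubstVar k i' j' × SubstVar (k + d) i' i
substVar-comm {k} {d} (below _) (below j<k) = _ , below j<k , below (≤-trans j<k (m≤m+n k d))
substVar-comm (below j<) (above k≤i) = _ , above k≤i , below (≤-pred j<)
substVar-comm {k} {d} (above k+d<j') (below j<k) =
  ⊥-elim (<⇒≱ j<k (≤-trans (≤-trans (m≤m+n k d) (n≤1+n _)) (≤-trans k+d<j' (n≤1+n _))))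
substVar-comm {j' = suc m} (above k+d<j') (above _) =
  m , above (≤-trans (m≤m+n _ _) (≤-pred k+d<j')) , above (≤-pred k+d<j')

private
  +-swap-inner : ∀ c d k → c + d + k ≡ c + (k + d)
  +-swap-inner c d k = trans (+-assoc c d k) (cong (c +_) (+-comm d k))

substVar-shift : ∀ {c k d i j} → SubstVar (c + d) i j → SubstVar (c + (k + d)) (shift c k i) (shift c k j)
substVar-shift {c} {k} {d} {j = j} (below j<) with j <? c
... | yes j<c rewrite shift-< {k = k} j<c = below (≤-trans j<c (m≤m+n c (k + d)))
... | no j≮c  rewrite shift-≥ {k = k} (≮⇒≥ j≮c) =
  below (subst (j + k <_) (+-swap-inner c d k) (+-monoˡ-< k j<))
substVar-shift {c} {k} {d} {i} (above c+d≤i)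
  rewrite shift-≥ {k = k} (≤-trans (m≤m+n c d) c+d≤i)
        | shift-≥ {k = k} (≤-trans (m≤m+n c d) (≤-trans c+d≤i (n≤1+n i)))
  = above (subst (_≤ i + k) (+-swap-inner c d k) (+-monoˡ-≤ k c+d≤i))

shift-substVar : ∀ {c k n} m → k ≤ n → SubstVar (c + k) (shift c n m) (shift c (suc n) m)
shift-substVar {c} {k} {n} m k≤n with m <? c
... | yes m<c rewrite shift-< {k = n} m<c | shift-< {k = suc n} m<c = below (≤-trans m<c (m≤m+n c k))
... | no m≮c  rewrite shift-≥ {k = n} (≮⇒≥ m≮c) | shift-≥ {k = suc n} (≮⇒≥ m≮c) | +-suc m n =
  above (+-mono-≤ (≮⇒≥ m≮c) k≤n)

shift-shift : ∀ {c c' k n} m → c ≤ n → shift (c' + c) k (shift c' n m) ≡ shift c' (n + k) m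
shift-shift {c} {c'} {k} {n} m c≤n with m <? c'
... | yes m<c' rewrite shift-< {k = n} m<c' | shift-< {k = n + k} m<c' = shift-< (≤-trans m<c' (m≤m+n c' c))
... | no m≮c'  rewrite shift-≥ {k = n} (≮⇒≥ m≮c') | shift-≥ {k = n + k} (≮⇒≥ m≮c') =
  trans (shift-≥ (+-mono-≤ (≮⇒≥ m≮c') c≤n)) (+-assoc m n k)

sub-body : ∀ P Q → St P → ℕ → Tm
sub-body P Q s k = at (subst₀ P Q) (inj₁ (s , k))

sub-arg : ∀ P Q → St Q → ℕ → ℕ → Tm
sub-arg P Q q k c = at (subst₀ P Q) (inj₂ (q , k , c))

module _ (P Q : Tm) where

  stepSub-var : ∀ {s k i j} → SubstVar k i j → step P s ≡ var j → stepSub P Q (inj₁ (s , k)) ≡ var i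
  stepSub-var {s} {k} {_} {j} v e rewrite e with compare j k | v
  ... | less _ _    | below _ = refl
  ... | less _ l    | above p = ⊥-elim (<⇒≱ (≤-trans (n<1+n _) (m≤m+n _ l)) (≤-trans p (n≤1+n _)))
  ... | equal _     | below p = ⊥-elim (<-irrefl refl p)
  ... | equal _     | above p = ⊥-elim (<⇒≱ (n<1+n _) p)
  ... | greater _ l | below p = ⊥-elim (<⇒≱ p (≤-trans (m≤m+n _ l) (n≤1+n _)))
  ... | greater _ _ | above _ = refl

  stepSub-hole : ∀ {s k} → step P s ≡ var k → stepSub P Q (inj₁ (s , k)) ≡ stepSub P Q (inj₂ (root Q , k , 0))
  stepSub-hole {s} {k} e = go e refl
    where
    go : ∀ {j} → step P s ≡ var j → j ≡ k →
         stepSub P Q (inj₁ (s , k)) ≡ stepSub P Q (inj₂ (root Q , k , 0))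
    go {j} e j≡k rewrite e with compare j k
    ... | less _ l    = ⊥-elim (<-irrefl j≡k (≤-trans (n<1+n _) (m≤m+n _ l)))
    ... | equal _     = refl
    ... | greater _ l = ⊥-elim (<-irrefl (sym j≡k) (≤-trans (n<1+n _) (m≤m+n _ l)))

  stepSub-lam : ∀ {s k x} → step P s ≡ lam x → stepSub P Q (inj₁ (s , k)) ≡ lam (inj₁ (x , suc k))
  stepSub-lam e rewrite e = refl

  stepSub-app : ∀ {s k x y} → step P s ≡ app x y →
                stepSub P Q (inj₁ (s , k)) ≡ app (inj₁ (x , k)) (inj₁ (y , k))
  stepSub-app e rewrite e = refl

  stepSub-shift-var : ∀ {q k c m} → step Q q ≡ var m → stepSub P Q (inj₂ (q , k , c)) ≡ var (shift c k m)
  stepSub-shift-var e rewrite e = refl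

  stepSub-shift-lam : ∀ {q k c x} → step Q q ≡ lam x →
                      stepSub P Q (inj₂ (q , k , c)) ≡ lam (inj₂ (x , k , suc c))
  stepSub-shift-lam e rewrite e = refl

  stepSub-shift-app : ∀ {q k c x y} → step Q q ≡ app x y →
                      stepSub P Q (inj₂ (q , k , c)) ≡ app (inj₂ (x , k , c)) (inj₂ (y , k , c))
  stepSub-shift-app e rewrite e = refl

Spine-resp : ∀ {Φ : Tm → Set₁} → (∀ {M M'} → Φ M → M ≅ M' → Φ M') →
             Spine Φ M → M ≅ M' → Spine Φ M'
Spine-resp Φ-resp (here p) b = here (Φ-resp p b)
Spine-resp Φ-resp (left e sp) b with out-app-≅ e b
... | _ , _ , e' , bA , _ = left e' (Spine-resp Φ-resp sp bA)

module _ (P Q : Tm) where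

  Lams-subst : ∀ {Φ : Tm → Set₁} → (∀ {s k} → Φ (at P s) → Φ (sub-body P Q s k)) →
               ∀ {s k} → Lams Φ (at P s) → Lams Φ (sub-body P Q s k)
  Lams-subst Φ-subst (here p) = here (Φ-subst p)
  Lams-subst Φ-subst {s} (under e lm) with out-lam-inv {at P s} e
  ... | _ , e' , refl = under (cong (mapF (at (subst₀ P Q))) (stepSub-lam P Q e')) (Lams-subst Φ-subst lm)

  Spine-subst : ∀ {Φ Ψ : Tm → Set₁} {k} → (∀ {s} → Φ (at P s) → Ψ (sub-body P Q s k)) →
                ∀ {s} → Spine Φ (at P s) → Spine Ψ (sub-body P Q s k)
  Spine-subst Φ-subst (here p) = here (Φ-subst p)
  Spine-subst Φ-subst {s} (left e sp) with out-app-inv {at P s} e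
  ... | _ , _ , e' , refl , refl =
    left (cong (mapF (at (subst₀ P Q))) (stepSub-app P Q e')) (Spine-subst Φ-subst sp)

  InfSpine-subst : ∀ {s k} → InfSpine (at P s) → InfSpine (sub-body P Q s k)
  InfSpine-subst {k = k} (S , s₀ , hS) = S' , (k , _ , refl , s₀) , post
    where
    S' : SubSt P Q → Set
    S' x = ∃ λ k' → ∃ λ s → x ≡ inj₁ (s , k') × S s
    post : ∀ x → S' x → AppLeft S' (stepSub P Q x)
    post _ (k' , s , refl , q) = go refl (hS s q)
      where
      go : ∀ {f} → step P s ≡ f → AppLeft S f → AppLeft S' (stepSub P Q (inj₁ (s , k')))
      go {app _ _} e q rewrite stepSub-app P Q {k = k'} e = k' , _ , refl , q

InfSpine-app : InfSpine M → InfSpine (M · A)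
InfSpine-app {M} {A} (S , s₀ , hS) = S' , _ , post
  where
  S' : St (M · A) → Set
  S' (inj₁ _)        = ⊤
  S' (inj₂ (inj₁ x)) = S x
  S' (inj₂ (inj₂ _)) = ⊥
  go : ∀ f → AppLeft S f → AppLeft S' (mapF (λ x → inj₂ (inj₁ x)) f)
  go (app _ _) q = q
  post : ∀ x → S' x → AppLeft S' (step (M · A) x)
  post (inj₁ _)        _ = s₀
  post (inj₂ (inj₁ x)) q = go (step M x) (hS x q)

subst-𝐎 : subst₀ 𝐎 Q ≅ 𝐎
subst-𝐎 = bisim (λ x _ → ∃ λ k → x ≡ inj₁ (tt , k)) (0 , refl) λ { _ _ (k , refl) → lam (suc k , refl) }

-- Hole d N M: M has the substituted variable d in head position, N stands in its place.
record HoleSpec : Set₂ where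
  field
    Hole        : ℕ → Tm → Tm → Set₁
    hole-respˡ  : ∀ {d} → Hole d N M → N ≅ N' → Hole d N' M
    hole-respʳ  : ∀ {d} → Hole d N M → M ≅ M' → Hole d N M'
    hole-¬lam   : ∀ {d} → Hole d N M → out M ≡ lam A → ⊥
    hole-¬redex : ∀ {d} → Hole d N M → out M ≡ app A B → out A ≡ lam P → ⊥
    hole-step   : ∀ {d} → Hole d N M → M →β M' → Hole d N M'
    hole-subst  : ∀ P Q P' Q' {s t k d} → Hole (suc (k + d)) (at P s) (at P' t) →
                  Hole (k + d) (sub-body P Q s k) (sub-body P' Q' t k)
    hole-shift  : ∀ P Q P' Q' {x y k c d} → Hole (c + d) (at Q x) (at Q' y) →
                  Hole (c + (k + d)) (sub-arg P Q x k c) (sub-arg P' Q' y k c)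

module Instances (spec : HoleSpec) where
  open HoleSpec spec

  InstNode : (ℕ → X → Y → Set r) → ℕ → F X → F Y → Set _
  InstNode R d = Node (SubstVar d) (R (suc d)) (R d)

  record Inst (d : ℕ) (N M : Tm) : Set₁ where
    constructor inst
    field
      IRel      : ℕ → St N → St M → Set
      irel-root : IRel d (root N) (root M)
      irel-step : ∀ e s t → IRel e s t → Hole e (at N s) (at M t) ⊎ InstNode IRel e (step N s) (step M t)
  open Inst

  Inst-unfold : ∀ {d} → Inst d N M → Hole d N M ⊎ InstNode Inst d (out N) (out M)
  Inst-unfold {N} {M} (inst R r h) with h _ _ _ r
  ... | inj₁ hole = inj₁ hole
  ... | inj₂ nd   =
    inj₂ (Node-mapFˡ (at N) (Node-mapFʳ (at M) (Node-map id (λ q → inst R q h) (λ q → inst R q h) nd)))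

  hole⇒Inst : ∀ {d} → Hole d N M → Inst d N M
  hole⇒Inst {N} {M} {d} hole =
    inst (λ e s t → e ≡ d × s ≡ root N × t ≡ root M) (refl , refl , refl)
         λ { _ _ _ (refl , refl , refl) → inj₁ hole }

  Inst-app : ∀ {d} → out N ≡ app A A' → out M ≡ app B B' → Inst d A B → Inst d A' B' → Inst d N M
  Inst-app {N} {M = M} {d = d} eN eM iA iA' with out-app-inv {N} eN | out-app-inv {M} eM
  ... | _ , _ , eN' , refl , refl | _ , _ , eM' , refl , refl = inst R (inj₁ (refl , refl , refl)) post
    where
    R : ℕ → St N → St M → Set
    R e s t = (e ≡ d × s ≡ root N × t ≡ root M) ⊎ IRel iA e s t ⊎ IRel iA' e s t
    post : ∀ e s t → R e s t → Hole e (at N s) (at M t) ⊎ InstNode R e (step N s) (step M t)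
    post _ _ _ (inj₁ (refl , refl , refl)) =
      inj₂ (subst₂ (InstNode R d) (sym eN') (sym eM')
                   (app (inj₂ (inj₁ (irel-root iA))) (inj₂ (inj₂ (irel-root iA')))))
    post e s t (inj₂ (inj₁ q)) with irel-step iA e s t q
    ... | inj₁ hole = inj₁ hole
    ... | inj₂ nd   = inj₂ (Node-map id (λ z → inj₂ (inj₁ z)) (λ z → inj₂ (inj₁ z)) nd)
    post e s t (inj₂ (inj₂ q)) with irel-step iA' e s t q
    ... | inj₁ hole = inj₁ hole
    ... | inj₂ nd   = inj₂ (Node-map id (λ z → inj₂ (inj₂ z)) (λ z → inj₂ (inj₂ z)) nd)

  Inst-lam : ∀ {d} → out N ≡ lam A → out M ≡ lam B → Inst (suc d) A B → Inst d N M
  Inst-lam {N} {M = M} {d = d} eN eM iA with out-lam-inv {N} eN | out-lam-inv {M} eM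
  ... | _ , eN' , refl | _ , eM' , refl = inst R (inj₁ (refl , refl , refl)) post
    where
    R : ℕ → St N → St M → Set
    R e s t = (e ≡ d × s ≡ root N × t ≡ root M) ⊎ IRel iA e s t
    post : ∀ e s t → R e s t → Hole e (at N s) (at M t) ⊎ InstNode R e (step N s) (step M t)
    post _ _ _ (inj₁ (refl , refl , refl)) =
      inj₂ (subst₂ (InstNode R d) (sym eN') (sym eM') (lam (inj₂ (irel-root iA))))
    post e s t (inj₂ q) with irel-step iA e s t q
    ... | inj₁ hole = inj₁ hole
    ... | inj₂ nd   = inj₂ (Node-map id inj₂ inj₂ nd)

  Inst-respˡ : ∀ {d} → Inst d N M → N ≅ N' → Inst d N' M
  Inst-respˡ {N} {M} {N'} (inst R r h) b = inst R' (_ , rel-root b , r) post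
    where
    R' : ℕ → St N' → St M → Set
    R' e s' t = ∃ λ s → Rel b s s' × R e s t
    post : ∀ e s' t → R' e s' t → Hole e (at N' s') (at M t) ⊎ InstNode R' e (step N' s') (step M t)
    post e s' t (s , q , p) with h e s t p
    ... | inj₁ hole = inj₁ (hole-respˡ hole (at-≅ b q))
    ... | inj₂ nd   = inj₂ (Node-respˡ (Pointwise-sym (rel-step b s s' q)) nd)

  Inst-respʳ : ∀ {d} → Inst d N M → M ≅ M' → Inst d N M'
  Inst-respʳ {N} {M} {M'} (inst R r h) b = inst R' (_ , r , rel-root b) post
    where
    R' : ℕ → St N → St M' → Set
    R' e s t' = ∃ λ t → R e s t × Rel b t t'
    post : ∀ e s t' → R' e s t' → Hole e (at N s) (at M' t') ⊎ InstNode R' e (step N s) (step M' t')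
    post e s t' (t , p , q) with h e s t p
    ... | inj₁ hole = inj₁ (hole-respʳ hole (at-≅ b q))
    ... | inj₂ nd   = inj₂ (Node-respʳ nd (rel-step b t t' q))

  Inst-·-app : ∀ {d} → out M ≡ app B B' → Inst d A B → Inst d A' B' → Inst d (A · A') M
  Inst-·-app e iA iA' = Inst-app refl e (Inst-respˡ iA (≅-sym (at-·ˡ _))) (Inst-respˡ iA' (≅-sym (at-·ʳ _)))

  Inst-app-· : ∀ {d} → out N ≡ app A A' → Inst d A B → Inst d A' B' → Inst d N (B · B')
  Inst-app-· e iA iA' = Inst-app e refl (Inst-respʳ iA (≅-sym (at-·ˡ _))) (Inst-respʳ iA' (≅-sym (at-·ʳ _)))

  module InstSubst {P Q P' Q' : Tm} {d : ℕ} (iP : Inst (suc d) P P') (iQ : Inst d Q Q') where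

    data R : ℕ → SubSt P Q → SubSt P' Q' → Set where
      body : ∀ {k s t} → IRel iP (suc (k + d)) s t → R (k + d) (inj₁ (s , k)) (inj₁ (t , k))
      arg  : ∀ {k c x y} → IRel iQ (c + d) x y → R (c + (k + d)) (inj₂ (x , k , c)) (inj₂ (y , k , c))

    Goal : ℕ → SubSt P Q → SubSt P' Q' → Set₁
    Goal e x y = Hole e (at (subst₀ P Q) x) (at (subst₀ P' Q') y) ⊎ InstNode R e (stepSub P Q x) (stepSub P' Q' y)

    arg-step : ∀ {k c x y} → IRel iQ (c + d) x y → Goal (c + (k + d)) (inj₂ (x , k , c)) (inj₂ (y , k , c))
    arg-step {k} {c} {x} {y} q with irel-step iQ (c + d) x y q
    ... | inj₁ hole = inj₁ (hole-shift P Q P' Q' hole)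
    ... | inj₂ nd   = inj₂ (arg-node refl refl nd)
      where
      arg-node : ∀ {f g} → step Q x ≡ f → step Q' y ≡ g → InstNode (IRel iQ) (c + d) f g →
                 InstNode R (c + (k + d)) (stepSub P Q (inj₂ (x , k , c))) (stepSub P' Q' (inj₂ (y , k , c)))
      arg-node e₁ e₂ (var v)
        rewrite stepSub-shift-var P Q {k = k} {c = c} e₁ | stepSub-shift-var P' Q' {k = k} {c = c} e₂
        = var (substVar-shift {c = c} {d = d} v)
      arg-node e₁ e₂ (lam p)
        rewrite stepSub-shift-lam P Q {k = k} {c = c} e₁ | stepSub-shift-lam P' Q' {k = k} {c = c} e₂
        = lam (arg p)
      arg-node e₁ e₂ (app p p')
        rewrite stepSub-shift-app P Q {k = k} {c = c} e₁ | stepSub-shift-app P' Q' {k = k} {c = c} e₂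
        = app (arg p) (arg p')

    -- At an occurrence of the substituted variable, both sides continue as copies of Q and Q'.
    body-var : ∀ {k s t i j} → step P s ≡ var i → step P' t ≡ var j → SubstVar (suc (k + d)) i j →
               Goal (k + d) (inj₁ (s , k)) (inj₁ (t , k))
    body-var {k} {j = j} e₁ e₂ v with hole-or-substVar k j
    ... | inj₂ (_ , u) with substVar-comm v u
    ...   | _ , u' , w rewrite stepSub-var P Q u' e₁ | stepSub-var P' Q' u e₂ = inj₂ (var w)
    body-var {k} e₁ e₂ v | inj₁ refl rewrite substVar-hole v with arg-step {k} {0} (irel-root iQ)
    ... | inj₁ hole =
      inj₁ (hole-respˡ (hole-respʳ hole (same-step-≅ {subst₀ P' Q'} (sym (stepSub-hole P' Q' e₂))))
                       (same-step-≅ {subst₀ P Q} (sym (stepSub-hole P Q e₁))))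
    ... | inj₂ nd rewrite stepSub-hole P Q e₁ | stepSub-hole P' Q' e₂ = inj₂ nd

    body-step : ∀ {k s t} → IRel iP (suc (k + d)) s t → Goal (k + d) (inj₁ (s , k)) (inj₁ (t , k))
    body-step {k} {s} {t} q with irel-step iP _ s t q
    ... | inj₁ hole = inj₁ (hole-subst P Q P' Q' hole)
    ... | inj₂ nd   = body-node refl refl nd
      where
      body-node : ∀ {f g} → step P s ≡ f → step P' t ≡ g → InstNode (IRel iP) (suc (k + d)) f g →
                  Goal (k + d) (inj₁ (s , k)) (inj₁ (t , k))
      body-node e₁ e₂ (var v) = body-var e₁ e₂ v
      body-node e₁ e₂ (lam p) rewrite stepSub-lam P Q {k = k} e₁ | stepSub-lam P' Q' {k = k} e₂ =
        inj₂ (lam (body p))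
      body-node e₁ e₂ (app p p') rewrite stepSub-app P Q {k = k} e₁ | stepSub-app P' Q' {k = k} e₂ =
        inj₂ (app (body p) (body p'))

    post : ∀ e x y → R e x y → Goal e x y
    post _ _ _ (body q) = body-step q
    post _ _ _ (arg q)  = arg-step q

  Inst-subst : ∀ {d} → Inst (suc d) P P' → Inst d Q Q' → Inst d (subst₀ P Q) (subst₀ P' Q')
  Inst-subst iP iQ = inst R (body (irel-root iP)) post
    where open InstSubst iP iQ

  module InstInit (P Q : Tm) (hole-at : ∀ {s k} → step P s ≡ var k → Hole k (sub-body P Q s k) (at P s)) where

    data R : ℕ → SubSt P Q → St P → Set where
      init : ∀ {s k} → R k (inj₁ (s , k)) s

    post : ∀ e x t → R e x t → Hole e (at (subst₀ P Q) x) (at P t) ⊎ InstNode R e (stepSub P Q x) (step P t)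
    post _ _ s (init {k = k}) = go refl
      where
      go : ∀ {f} → step P s ≡ f →
           Hole k (sub-body P Q s k) (at P s) ⊎ InstNode R k (stepSub P Q (inj₁ (s , k))) f
      go {var j} e with hole-or-substVar k j
      ... | inj₁ refl    = inj₁ (hole-at e)
      ... | inj₂ (_ , u) rewrite stepSub-var P Q u e = inj₂ (var u)
      go {lam _} e   rewrite stepSub-lam P Q {k = k} e = inj₂ (lam init)
      go {app _ _} e rewrite stepSub-app P Q {k = k} e = inj₂ (app init init)

  Inst-init : ∀ P Q → (∀ {s k} → step P s ≡ var k → Hole k (sub-body P Q s k) (at P s)) →
              ∀ s k → Inst k (sub-body P Q s k) (at P s)
  Inst-init P Q hole-at s k = inst R init post
    where open InstInit P Q hole-at

  Inst-redex-inv : ∀ {d} → Inst d N M → out M ≡ app A B → out A ≡ lam P →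
                   ∃₂ λ A' B' → ∃ λ P' → out N ≡ app A' B' × out A' ≡ lam P' ×
                                        Inst (suc d) P' P × Inst d B' B
  Inst-redex-inv i e₁ e₂ with Inst-unfold i
  ... | inj₁ hole = ⊥-elim (hole-¬redex hole e₁ e₂)
  ... | inj₂ nd with Node-appʳ nd e₁
  ... | A' , B' , eN , iA , iB with Inst-unfold iA
  ... | inj₁ hole = ⊥-elim (hole-¬lam hole e₂)
  ... | inj₂ ndA with Node-lamʳ ndA e₂
  ... | P' , eA' , iP = A' , B' , P' , eN , eA' , iP , iB

  Redex-Inst : ∀ {d} → Inst d N M → Redex M → Redex N
  Redex-Inst i (_ , _ , _ , e₁ , e₂) with Inst-redex-inv i e₁ e₂
  ... | A' , B' , P' , eN , eA' , _ = A' , B' , P' , eN , eA'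

  Inst-lift-→β : ∀ {d} → Inst d N M → M →β M' → ∃ λ N' → N ↠β N' × Inst d N' M'
  Inst-lift-→β {M' = M'} i (β {B = B} {P = P} e₁ e₂ sb) with Inst-redex-inv i e₁ e₂
  ... | _ , B' , P' , eN , eA' , iP , iB =
    subst₀ P' B' , →β⇒↠β (→β-contract eN eA') ,
    Inst-respʳ (Inst-subst iP iB) (≈⇒≅ {subst₀ P B} {M'} sb)
  Inst-lift-→β i (ξlam e₁ e₂ r) with Inst-unfold i
  ... | inj₁ hole = ⊥-elim (hole-¬lam hole e₁)
  ... | inj₂ nd with Node-lamʳ nd e₁
  ... | A , eN , iA with Inst-lift-→β iA r
  ... | A' , rs , iA' = lamₜ A' , ↠β-lam eN ≅-refl rs , Inst-lam refl e₂ (Inst-respˡ iA' (≅-sym (at-lamₜ _)))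
  Inst-lift-→β {N} i r₀@(ξl {B = B} {B' = B'} e₁ e₂ r bB) with Inst-unfold i
  ... | inj₁ hole = N , ↠β-refl , hole⇒Inst (hole-step hole r₀)
  ... | inj₂ nd with Node-appʳ nd e₁
  ... | A , BN , eN , iA , iB with Inst-lift-→β iA r
  ... | A' , rs , iA' =
    A' · BN , ↠β-appˡ eN ≅-refl ≅-refl rs ,
    Inst-·-app e₂ iA' (Inst-respʳ iB (≈⇒≅ {B} {B'} bB))
  Inst-lift-→β {N} i r₀@(ξr {A = A} {A' = A'} e₁ e₂ bA r) with Inst-unfold i
  ... | inj₁ hole = N , ↠β-refl , hole⇒Inst (hole-step hole r₀)
  ... | inj₂ nd with Node-appʳ nd e₁
  ... | AN , B , eN , iA , iB with Inst-lift-→β iB r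
  ... | B' , rs , iB' =
    AN · B' , ↠β-appʳ eN ≅-refl ≅-refl rs ,
    Inst-·-app e₂ (Inst-respʳ iA (≈⇒≅ {A} {A'} bA)) iB'

  Inst-lift-↠β : ∀ {d} → Inst d N M → M ↠β M' → ∃ λ N' → N ↠β N' × Inst d N' M'
  Inst-lift-↠β {N} {M} {M'} i (done b) = N , ↠β-refl , Inst-respʳ i (≈⇒≅ {M} {M'} b)
  Inst-lift-↠β i (r ◅ rs) with Inst-lift-→β i r
  ... | _ , rs₁ , i₁ with Inst-lift-↠β i₁ rs
  ... | N₂ , rs₂ , i₂ = N₂ , ↠β-trans rs₁ rs₂ , i₂

RootActive-resp : RootActive M → M ≅ M' → RootActive M'
RootActive-resp ra b N rs = ra N (↠β-respˡ (≅-sym b) rs)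

IsVar : ℕ → Tm → Set₁
IsVar d H = Lift (Level.suc 0ℓ) (out H ≡ var d)

IsVar-resp : ∀ {d} → IsVar d M → M ≅ M' → IsVar d M'
IsVar-resp (lift e) b = lift (out-var-≅ e b)

private
  var≢lam : ∀ {i} → out M ≡ var i → out M ≢ lam A
  var≢lam e e' with trans (sym e) e'
  ... | ()

  var≢app : ∀ {i} → out M ≡ var i → out M ≢ app A B
  var≢app e e' with trans (sym e) e'
  ... | ()

  app≢lam : out M ≡ app A B → out M ≢ lam A'
  app≢lam e e' with trans (sym e) e'
  ... | ()

IsVar-¬→β : ∀ {d} → IsVar d M → M →β M' → ⊥
IsVar-¬→β (lift e) (β e₁ _ _)    = var≢app e e₁
IsVar-¬→β (lift e) (ξlam e₁ _ _) = var≢lam e e₁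
IsVar-¬→β (lift e) (ξl e₁ _ _ _) = var≢app e e₁
IsVar-¬→β (lift e) (ξr e₁ _ _ _) = var≢app e e₁

module _ {d : ℕ} where

  headSpine-¬lam : Spine (IsVar d) M → out M ≢ lam A
  headSpine-¬lam (here (lift e)) = var≢lam e
  headSpine-¬lam (left e _)      = app≢lam e

  headSpine-¬redex : Spine (IsVar d) M → out M ≡ app A B → out A ≡ lam P → ⊥
  headSpine-¬redex (here (lift e)) e₁ _ = var≢app e e₁
  headSpine-¬redex (left e sp) e₁ e₂ with trans (sym e) e₁
  ... | refl = headSpine-¬lam sp e₂

  headSpine-→β : Spine (IsVar d) M → M →β M' → Spine (IsVar d) M'
  headSpine-→β sp          (β e₁ e₂ _)   = ⊥-elim (headSpine-¬redex sp e₁ e₂)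
  headSpine-→β sp          (ξlam e₁ _ _) = ⊥-elim (headSpine-¬lam sp e₁)
  headSpine-→β (here v)    r             = ⊥-elim (IsVar-¬→β v r)
  headSpine-→β (left e sp) (ξl e₁ e₂ r _) with trans (sym e) e₁
  ... | refl = left e₂ (headSpine-→β sp r)
  headSpine-→β (left e sp) (ξr {A = A} {A' = A'} e₁ e₂ bA _) with trans (sym e) e₁
  ... | refl = left e₂ (Spine-resp IsVar-resp sp (≈⇒≅ {A} {A'} bA))

module _ (P Q : Tm) where

  IsVar-subst : ∀ {k d t} → IsVar (suc (k + d)) (at P t) → IsVar (k + d) (sub-body P Q t k)
  IsVar-subst {k} {d} {t} (lift e) =
    lift (cong (mapF (at (subst₀ P Q))) (stepSub-var P Q (above (m≤m+n k d)) (out-var-inv {at P t} e)))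

  IsVar-shift : ∀ {k c d y} → IsVar (c + d) (at Q y) → IsVar (c + (k + d)) (sub-arg P Q y k c)
  IsVar-shift {k} {c} {d} {y} (lift e) =
    lift (cong (mapF (at (subst₀ P Q))) (trans (stepSub-shift-var P Q (out-var-inv {at Q y} e))
                                               (cong var (trans (shift-≥ (m≤m+n c d)) (+-swap-inner c d k)))))

  headSpine-shift : ∀ {k c d y} → Spine (IsVar (c + d)) (at Q y) →
                    Spine (IsVar (c + (k + d))) (sub-arg P Q y k c)
  headSpine-shift (here v) = here (IsVar-shift v)
  headSpine-shift {y = y} (left e sp) with out-app-inv {at Q y} e
  ... | _ , _ , e' , refl , refl =
    left (cong (mapF (at (subst₀ P Q))) (stepSub-shift-app P Q e')) (headSpine-shift sp)

headSpineHoles : HoleSpec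
headSpineHoles = record
  { Hole        = λ d N M → Spine (IsVar d) M
  ; hole-respˡ  = λ sp _ → sp
  ; hole-respʳ  = Spine-resp IsVar-resp
  ; hole-¬lam   = headSpine-¬lam
  ; hole-¬redex = headSpine-¬redex
  ; hole-step   = headSpine-→β
  ; hole-subst  = λ _ _ P' Q' → Spine-subst P' Q' (IsVar-subst P' Q')
  ; hole-shift  = λ _ _ P' Q' → headSpine-shift P' Q'
  }

module _ where
  open Instances headSpineHoles

  Inst-project-→β : ∀ {d} → Inst d N M → N →β N' → ∃ λ M' → M ↠β M' × Inst d N' M'
  Inst-project-→β {M = M} i r with Inst-unfold i
  ... | inj₁ hole = M , ↠β-refl , hole⇒Inst hole
  Inst-project-→β {M = M} {N'} i (β {B = B} {P = P} e₁ e₂ sb) | inj₂ nd with Node-appˡ nd e₁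
  ... | A , B' , eM , iA , iB with Inst-unfold iA
  ... | inj₁ hole = M , ↠β-refl , hole⇒Inst (left eM hole)
  ... | inj₂ ndA with Node-lamˡ ndA e₂
  ... | P' , eA , iP =
    subst₀ P' B' , →β⇒↠β (→β-contract eM eA) ,
    Inst-respˡ (Inst-subst iP iB) (≈⇒≅ {subst₀ P B} {N'} sb)
  Inst-project-→β i (ξlam e₁ e₂ r) | inj₂ nd with Node-lamˡ nd e₁
  ... | A , eM , iA with Inst-project-→β iA r
  ... | A' , rs , iA' = lamₜ A' , ↠β-lam eM ≅-refl rs , Inst-lam e₂ refl (Inst-respʳ iA' (≅-sym (at-lamₜ _)))
  Inst-project-→β i (ξl {B = B} {B' = B'} e₁ e₂ r bB) | inj₂ nd with Node-appˡ nd e₁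
  ... | A , BM , eM , iA , iB with Inst-project-→β iA r
  ... | A' , rs , iA' =
    A' · BM , ↠β-appˡ eM ≅-refl ≅-refl rs ,
    Inst-app-· e₂ iA' (Inst-respˡ iB (≈⇒≅ {B} {B'} bB))
  Inst-project-→β i (ξr {A = A} {A' = A'} e₁ e₂ bA r) | inj₂ nd with Node-appˡ nd e₁
  ... | AM , B , eM , iA , iB with Inst-project-→β iB r
  ... | B' , rs , iB' =
    AM · B' , ↠β-appʳ eM ≅-refl ≅-refl rs ,
    Inst-app-· e₂ (Inst-respˡ iA (≈⇒≅ {A} {A'} bA)) iB'

  Inst-project-↠β : ∀ {d} → Inst d N M → N ↠β N' → ∃ λ M' → M ↠β M' × Inst d N' M'
  Inst-project-↠β {N} {M} {N'} i (done b) = M , ↠β-refl , Inst-respˡ i (≈⇒≅ {N} {N'} b)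
  Inst-project-↠β i (r ◅ rs) with Inst-project-→β i r
  ... | _ , rs₁ , i₁ with Inst-project-↠β i₁ rs
  ... | M₂ , rs₂ , i₂ = M₂ , ↠β-trans rs₁ rs₂ , i₂

  RootActive-Inst : ∀ {d} → Inst d N M → RootActive M → RootActive N
  RootActive-Inst i ra N₁ rs with Inst-project-↠β i rs
  ... | M₁ , ms , i₁ with ra M₁ ms
  ... | _ , ms' , redex with Inst-lift-↠β i₁ ms'
  ... | N₂ , ns , i₂ = N₂ , ns , Redex-Inst i₂ redex

  RootActive-subst : ∀ P Q s k → RootActive (at P s) → RootActive (sub-body P Q s k)
  RootActive-subst P Q s k = RootActive-Inst (Inst-init P Q (λ e → here (lift (cong (mapF (at P)) e))) s k)

module _ {R : Tm → Tm → Set₁} where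

  data UpToBisim : Tm → Tm → Set₁ where
    via       : K ≅ K' → R K' L' → L' ≅ L → UpToBisim K L
    bisimilar : K ≅ L → UpToBisim K L

  UpToBisim-respʳ : UpToBisim K L → L ≅ L' → UpToBisim K L'
  UpToBisim-respʳ (via b₁ r b₂)  b = via b₁ r (≅-trans b₂ b)
  UpToBisim-respʳ (bisimilar b') b = bisimilar (≅-trans b' b)

  ↠∞-upTo : (∀ K L → R K L → ScStep UpToBisim K L) → UpToBisim K L → K ↠∞ L
  ↠∞-upTo h u = UpToBisim , u , post
    where
    post : ∀ K L → UpToBisim K L → ScStep UpToBisim K L
    post K L (via {K' = K₀} {L₀} b₁ r b₂) with h K₀ L₀ r
    ... | K₁ , rs , fr =
      K₁ , ↠β-respˡ (≅-sym b₁) rs ,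
      Pointwise⇒FRel (Pointwise-map (λ { (_ , u , b) → UpToBisim-respʳ u b })
                                    (Pointwise-trans (FRel⇒Pointwise (out K₁) (out L₀) fr) (out-≅ b₂)))
    post K L (bisimilar b) = K , ↠β-refl , Pointwise⇒FRel (Pointwise-map bisimilar (out-≅ b))

↠∞-respʳ : M ↠∞ N → N ≅ N' → M ↠∞ N'
↠∞-respʳ (R , r , h) b = ↠∞-upTo post (via ≅-refl r b)
  where
  post : ∀ K L → R K L → ScStep UpToBisim K L
  post K L r with h K L r
  ... | K₁ , rs , fr = K₁ , rs , FRel-map (λ r → via ≅-refl r ≅-refl) (out K₁) (out L) fr

↠∞-prefix : M ↠β M' → M' ↠∞ N → M ↠∞ N
↠∞-prefix {M} {M'} rs (R , r , h) = R' , (M' , rs , r) , post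
  where
  R' : Tm → Tm → Set₁
  R' K L = ∃ λ K' → K ↠β K' × R K' L
  post : ∀ K L → R' K L → ScStep R' K L
  post K L (K' , rs , r) with h K' L r
  ... | K₁ , rs₁ , fr = K₁ , ↠β-trans rs rs₁ , FRel-map (λ r → _ , ↠β-refl , r) (out K₁) (out L) fr

module AppFun {R : Tm → Tm → Set₁} (h : ∀ K L → R K L → ScStep R K L) where

  data AppRel : Tm → Tm → Set₁ where
    base : R K L → AppRel K L
    fun  : R K L → AppRel (K · A) (L · A)

  post : ∀ K L → AppRel K L → ScStep UpToBisim K L
  post K L (base r) with h K L r
  ... | K₁ , rs , fr = K₁ , rs , FRel-map (λ r → via ≅-refl (base r) ≅-refl) (out K₁) (out L) fr
  post _ _ (fun {K} {L} {A} r) =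
    K · A , ↠β-refl , via (at-·ˡ (root K)) (base r) (≅-sym (at-·ˡ (root L))) ,
                      bisimilar (≅-trans (at-·ʳ (root A)) (≅-sym (at-·ʳ (root A))))

↠∞-appˡ : M ↠∞ N → (M · A) ↠∞ (N · A)
↠∞-appˡ (R , r , h) = ↠∞-upTo post (via ≅-refl (fun r) ≅-refl)
  where open AppFun h

↠∞-lam-inv : M ↠∞ N → out N ≡ lam B → ∃₂ λ M' A → M ↠β M' × out M' ≡ lam A × A ↠∞ B
↠∞-lam-inv {M} {N} (R , r , h) e with h M N r
... | M' , rs , fr with Node-lamʳ (FRel⇒Pointwise (out M') (out N) fr) e
... | A , eA , rA = M' , A , rs , eA , (R , rA , h)

ShiftNode : (ℕ → X → Y → Set r) → ℕ → ℕ → F X → F Y → Set _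
ShiftNode R n c = Node (λ i j → i ≡ shift c n j) (R (suc c)) (R c)

-- Shifted n c X E: X is E with its indices from c upwards raised by n.
record Shifted (n c : ℕ) (X E : Tm) : Set₁ where
  constructor shifted
  field
    SRel      : ℕ → St X → St E → Set
    srel-root : SRel c (root X) (root E)
    srel-step : ∀ c' x e → SRel c' x e → ShiftNode SRel n c' (step X x) (step E e)

Shifted-respˡ : ∀ {n c X X' E} → Shifted n c X E → X ≅ X' → Shifted n c X' E
Shifted-respˡ {X = X} {X'} {E} (shifted R r h) b = shifted R' (_ , rel-root b , r) post
  where
  R' : ℕ → St X' → St E → Set
  R' c x' e = ∃ λ x → Rel b x x' × R c x e
  post : ∀ c x' e → R' c x' e → ShiftNode R' _ c (step X' x') (step E e)
  post c x' e (x , q , p) = Node-respˡ (Pointwise-sym (rel-step b x x' q)) (h c x e p)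

module ShiftedSubst (P Q E : Tm) {n k : ℕ} (k≤n : k ≤ n) (Rs : ℕ → St P → St E → Set)
                    (hs : ∀ c x e → Rs c x e → ShiftNode Rs (suc n) c (step P x) (step E e)) where

  data R : ℕ → SubSt P Q → St E → Set where
    body : ∀ {c s e} → Rs c s e → R c (inj₁ (s , c + k)) e

  post : ∀ c x e → R c x e → ShiftNode R n c (stepSub P Q x) (step E e)
  post c _ e (body {s = s} q) = go refl (hs c s e q)
    where
    go : ∀ {f g} → step P s ≡ f → ShiftNode Rs (suc n) c f g → ShiftNode R n c (stepSub P Q (inj₁ (s , c + k))) g
    go e₁ (var {j = m} refl) rewrite stepSub-var P Q (shift-substVar {c} m k≤n) e₁ = var refl
    go e₁ (lam p)            rewrite stepSub-lam P Q {k = c + k} e₁ = lam (body p)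
    go e₁ (app p p')         rewrite stepSub-app P Q {k = c + k} e₁ = app (body p) (body p')

Shifted-subst : ∀ P Q {E n k s} → k ≤ n → Shifted (suc n) 0 (at P s) E → Shifted n 0 (sub-body P Q s k) E
Shifted-subst P Q {E} k≤n (shifted Rs r hs) = shifted R (body r) post
  where open ShiftedSubst P Q E k≤n Rs hs

module ShiftedShift (P Q E : Tm) {n k c : ℕ} (c≤n : c ≤ n) (Rs : ℕ → St Q → St E → Set)
                    (hs : ∀ c x e → Rs c x e → ShiftNode Rs n c (step Q x) (step E e)) where

  data R : ℕ → SubSt P Q → St E → Set where
    arg : ∀ {c' x e} → Rs c' x e → R c' (inj₂ (x , k , c' + c)) e

  post : ∀ c' y e → R c' y e → ShiftNode R (n + k) c' (stepSub P Q y) (step E e)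
  post c' _ e (arg {x = x} q) = go refl (hs c' x e q)
    where
    go : ∀ {f g} → step Q x ≡ f → ShiftNode Rs n c' f g →
         ShiftNode R (n + k) c' (stepSub P Q (inj₂ (x , k , c' + c))) g
    go e₁ (var {j = m} refl) rewrite stepSub-shift-var P Q {k = k} {c = c' + c} e₁ =
      var (shift-shift {c' = c'} m c≤n)
    go e₁ (lam p)    rewrite stepSub-shift-lam P Q {k = k} {c = c' + c} e₁ = lam (arg p)
    go e₁ (app p p') rewrite stepSub-shift-app P Q {k = k} {c = c' + c} e₁ = app (arg p) (arg p')

Shifted-shift : ∀ P Q {E n k c x} → c ≤ n → Shifted n 0 (at Q x) E → Shifted (n + k) 0 (sub-arg P Q x k c) E
Shifted-shift P Q {E} c≤n (shifted Rs r hs) = shifted R (arg r) post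
  where open ShiftedShift P Q E c≤n Rs hs

module ShiftedCopy (P Q : Tm) (k : ℕ) where

  data R : ℕ → SubSt P Q → St Q → Set where
    copy : ∀ {c q} → R c (inj₂ (q , k , c)) q

  post : ∀ c y q → R c y q → ShiftNode R k c (stepSub P Q y) (step Q q)
  post c _ q copy = go refl
    where
    go : ∀ {g} → step Q q ≡ g → ShiftNode R k c (stepSub P Q (inj₂ (q , k , c))) g
    go {var _}   e rewrite stepSub-shift-var P Q {k = k} {c = c} e = var refl
    go {lam _}   e rewrite stepSub-shift-lam P Q {k = k} {c = c} e = lam copy
    go {app _ _} e rewrite stepSub-shift-app P Q {k = k} {c = c} e = app copy copy

Shifted-copy : ∀ P Q k q c → Shifted k c (sub-arg P Q q k c) (at Q q)
Shifted-copy P Q k q c = shifted R copy post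
  where open ShiftedCopy P Q k

-- A hole is the variable d itself, filled by E shifted over the d binders above it.
copyHoles : Tm → HoleSpec
copyHoles E = record
  { Hole        = λ d N M → IsVar d M × Shifted d 0 N E
  ; hole-respˡ  = λ { (v , sh) b → v , Shifted-respˡ sh b }
  ; hole-respʳ  = λ { (v , sh) b → IsVar-resp v b , sh }
  ; hole-¬lam   = λ { (v , _) → headSpine-¬lam (here v) }
  ; hole-¬redex = λ { (v , _) → headSpine-¬redex (here v) }
  ; hole-step   = λ { (v , _) r → ⊥-elim (IsVar-¬→β v r) }
  ; hole-subst  = λ { P Q P' Q' {k = k} {d} (v , sh) → IsVar-subst P' Q' v , Shifted-subst P Q (m≤m+n k d) sh }
  ; hole-shift  = λ { P Q P' Q' {x} {k = k} {c} {d} (v , sh) →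
                      IsVar-shift P' Q' v ,
                      subst (λ n → Shifted n 0 (sub-arg P Q x k c) E) (+-swap-inner c d k)
                            (Shifted-shift P Q (m≤m+n c d) sh) }
  }

copyHole-at : ∀ {s k} → step P s ≡ var k → IsVar k (at P s) × Shifted k 0 (sub-body P Q s k) Q
copyHole-at {P} {Q} e =
  lift (cong (mapF (at P)) e) ,
  Shifted-respˡ (Shifted-copy P Q _ (root Q) 0) (same-step-≅ {subst₀ P Q} (sym (stepSub-hole P Q e)))

module SubstInf (Q : Tm) {R : Tm → Tm → Set₁} (h : ∀ K L → R K L → ScStep R K L) where
  open Instances (copyHoles Q)

  data R∞ : Tm → Tm → Set₁ where
    instances : ∀ {d K M L T} → Inst d K M → R M L → Inst d T L → R∞ K T
    copies    : ∀ {n c q K T} → Shifted n c K (at Q q) → Shifted n c T (at Q q) → R∞ K T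

  copies-step : ∀ {n c q} → Shifted n c K (at Q q) → Shifted n c L (at Q q) → Pointwise R∞ (out K) (out L)
  copies-step {K} {L} {n} (shifted SK rK hK) (shifted SL rL hL) = go (hK _ _ _ rK) (hL _ _ _ rL)
    where
    go : ∀ {c f f' g} → ShiftNode SK n c f g → ShiftNode SL n c f' g →
         Pointwise R∞ (mapF (at K) f) (mapF (at L) f')
    go (var refl) (var refl) = var refl
    go (lam p)    (lam p')   = lam (copies (shifted SK p hK) (shifted SL p' hL))
    go (app p q)  (app p' q') =
      app (copies (shifted SK p hK) (shifted SL p' hL)) (copies (shifted SK q hK) (shifted SL q' hL))

  instances-step : ∀ {d f g f' g'} → InstNode Inst d f g → Pointwise R g g' → InstNode Inst d f' g' →
                   Pointwise R∞ f f'
  instances-step (var v)   (var refl) (var v')    = var (substVar-functional v v')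
  instances-step (lam p)   (lam q)    (lam p')    = lam (instances p q p')
  instances-step (app p q) (app r r') (app p' q') = app (instances p r p') (instances q r' q')

  post : ∀ K L → R∞ K L → ScStep R∞ K L
  post K L (copies shK shL) = K , ↠β-refl , Pointwise⇒FRel (copies-step shK shL)
  post K L (instances {d} {M = M} {L = L'} iK r iL) with h M L' r
  ... | M' , ms , fr with Inst-lift-↠β iK ms
  ... | K' , ks , iK' with Inst-unfold iK' | Inst-unfold iL | FRel⇒Pointwise (out M') (out L') fr
  ... | inj₁ (_ , shK)     | inj₁ (_ , shL) | _  = K' , ks , Pointwise⇒FRel (copies-step shK shL)
  ... | inj₂ nK            | inj₂ nL        | pw = K' , ks , Pointwise⇒FRel (instances-step nK pw nL)
  ... | inj₁ (lift eM , _) | inj₂ nL        | pw with Node-varˡ pw eM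
  ...   | _ , eL , refl with Node-varʳ nL eL
  ...     | _ , _ , v = ⊥-elim (substVar-¬hole v)
  post K L (instances iK r iL) | M' , ms , fr | K' , ks , iK'
    | inj₂ nK | inj₁ (lift eL , _) | pw with Node-varʳ pw eL
  ...   | _ , eM , refl with Node-varʳ nK eM
  ...     | _ , _ , v = ⊥-elim (substVar-¬hole v)

subst-↠∞ : P ↠∞ L → subst₀ P Q ↠∞ subst₀ L Q
subst-↠∞ {P} {L} {Q} (R , r , h) =
  R∞ , instances (Inst-init P Q copyHole-at (root P) 0) r (Inst-init L Q copyHole-at (root L) 0) , post
  where
  open SubstInf Q h
  open Instances (copyHoles Q) using (Inst-init)

↠∞-head-β : M ↠∞ N → out N ≡ lam A → (M · B) ↠∞ subst₀ A B
↠∞-head-β i e with ↠∞-lam-inv i e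
... | _ , _ , rs , e' , i' = ↠∞-prefix (↠β-head-β rs e') (subst-↠∞ i')

HA-app : HA M → HA (M · A)
HA-app {A = A} (N , rs , here sp) =
  N · A , ↠β-appˡ refl (at-·ˡ _) (at-·ʳ _) rs ,
  here (left refl (Spine-resp RootActive-resp sp (≅-sym (at-·ˡ _))))
HA-app {A = A} (N , rs , under {A = B} e lm) =
  subst₀ B A , ↠β-head-β rs e , Lams-subst B A (Spine-subst B A (RootActive-subst B A _ _)) lm

IL-app : IL M → IL (M · A)
IL-app {A = A} (N , i , here sp) = N · A , ↠∞-appˡ i , here (InfSpine-app sp)
IL-app {A = A} (N , i , under {A = B} e lm) = subst₀ B A , ↠∞-head-β i e , Lams-subst B A (InfSpine-subst B A) lm

𝒪-app : 𝒪 M → 𝒪 (M · A)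
𝒪-app i = ↠∞-respʳ (↠∞-head-β i refl) subst-𝐎

∈-app : (X : Class) → M ∈ X → (M · A) ∈ X
∈-app HA-c   (lift h) = lift (HA-app h)
∈-app IL-c   h        = IL-app h
∈-app O-c    h        = 𝒪-app h
∈-app IL∪O-c (inj₁ h) = inj₁ (IL-app h)
∈-app IL∪O-c (inj₂ h) = inj₂ (𝒪-app h)

lemma10 : (X : Class) (U N : Tm) → U ∈ X → (¬ₜ U) ∈ X × (U ∧ₜ N) ∈ X × (U ∨ₜ N) ∈ X × (U ⇒ₜ N) ∈ X
lemma10 X U N h = app₂ 𝐅 𝐓 , app₂ N U , app₂ U N , app₂ N 𝐓
  where
  app₂ : ∀ A B → (U · A · B) ∈ X
  app₂ A B = ∈-app X (∈-app X h)
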